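{- Let $L$ be a co-Heyting algebra and let $(a_n)_{n<\omega},(b_n)_{n<\omega},(c_n)_{n<\omega}$ be sequences in $L$ with $c_n\le b_n\le a_n$ for every $n$. If $(a_n)$ and $(c_n)$ both converge to the same $l\in L$ for the codimetric pseudometric, then $(b_n)$ converges to $l$.
   Context: A co-Heyting algebra is a bounded distributive lattice $(L,0,1,\vee,\wedge)$ such that $a-b=\min\{c\in L: a\le b\vee c\}$ exists for all $a,b$. Let $a\triangle b=(a-b)\vee(b-a)$. $\operatorname{Spec}L$ is the set of prime filters ordered by inclusion; height = foundation rank there; $\operatorname{codim}_La=\min\{\operatorname{height}\mathfrak p: a\in\mathfrak p\}$ ($+\infty$ if none). The codimetric pseudometric is $\operatorname{dist}_L(a,b)=2^{ -\operatorname{codim}_L(a\triangle b)}$ if finite and $0$ otherwise; $(x_n)$ converges to $y$ iff $\operatorname{dist}_L(x_n,y)\to0$. -}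

module Defs where

open import Level using (Level; 0ℓ; _⊔_) renaming (suc to lsuc)
open import Data.Empty using (⊥-elim)
open import Data.Nat using (ℕ; zero; suc)
import Data.Nat as ℕ
open import Data.Nat.Properties using (<-cmp)
open import Data.Product using (_×_; _,_; ∃; ∃-syntax)
open import Data.Rational using (ℚ; 0ℚ; ½; +-*-rawSemiring) renaming (_<_ to _<ℚ_)
open import Data.Sum using (_⊎_; inj₁; inj₂)
open import Data.Unit.Polymorphic using (tt) renaming (⊤ to Unit)
open import Algebra.Core using (Op₂)
open import Algebra.Definitions using (_DistributesOverˡ_)
open import Algebra.Definitions.RawSemiring +-*-rawSemiring using (_^_)
open import Relation.Binary.Core using (Rel)
open import Relation.Binary.Definitions using (tri<; tri≈; tri>)
open import Relation.Binary.Lattice.Bundles using (BoundedLattice)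
open import Relation.Binary.PropositionalEquality using (_≡_; refl; sym; trans; cong)
open import Relation.Nullary using (¬_)
open import Relation.Unary using (Pred; _⊂_)

private
  variable
    a r ι c ℓ₁ ℓ₂ : Level

IsMin : {A : Set a} {ℓ : Level} → Rel A r → Pred A ℓ → A → Set (a ⊔ r ⊔ ℓ)
IsMin _≤_ P m = P m × (∀ x → P x → m ≤ x)

record CoHeytingAlgebra c ℓ₁ ℓ₂ : Set (lsuc (c ⊔ ℓ₁ ⊔ ℓ₂)) where
  infixl 6 _-_
  field
    boundedLattice : BoundedLattice c ℓ₁ ℓ₂

  open BoundedLattice boundedLattice public

  field
    ∧-distribˡ-∨ : _DistributesOverˡ_ _≈_ _∧_ _∨_
    _-_          : Op₂ Carrier
    -‿isMin      : ∀ a b → IsMin _≤_ (λ c → a ≤ b ∨ c) (a - b)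

  infixl 6 _△_
  _△_ : Op₂ Carrier
  a △ b = (a - b) ∨ (b - a)

-- Notations for ordinals; `lim f` stands for the supremum of the family f.
data Ordinal ι : Set (lsuc ι) where
  zero : Ordinal ι
  suc  : Ordinal ι → Ordinal ι
  lim  : {I : Set ι} → (I → Ordinal ι) → Ordinal ι

fromℕ : ℕ → Ordinal 0ℓ
fromℕ zero    = zero
fromℕ (suc n) = suc (fromℕ n)

-- Elements below which the relation is not well-founded have rank +∞: they
-- satisfy α ≤rk x for every α.
module FoundationRank {A : Set a} (_<_ : Rel A r) where

  infix 4 _≤rk_ rk_<_ rk_is_

  _≤rk_ : Ordinal ι → A → Set (a ⊔ r ⊔ ι)
  _≤rk_ {ι} zero x    = Unit
  _≤rk_ {ι} (suc α) x = ∃[ y ] (y < x × α ≤rk y)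
  _≤rk_ {ι} (lim f) x = ∀ i → f i ≤rk x

  rk_<_ : A → Ordinal ι → Set (a ⊔ r ⊔ ι)
  rk x < α = ¬ (α ≤rk x)

  rk_is_ : A → Ordinal ι → Set (a ⊔ r ⊔ ι)
  rk x is α = α ≤rk x × rk x < suc α

module Codimetric (L : CoHeytingAlgebra c ℓ₁ ℓ₂) where
  open CoHeytingAlgebra L using (Carrier; _≤_; _∨_; _∧_; ⊤; ⊥; _△_)

  record PrimeFilter : Set (lsuc (c ⊔ ℓ₁ ⊔ ℓ₂)) where
    field
      members  : Pred Carrier (c ⊔ ℓ₁ ⊔ ℓ₂)
      ⊤-mem    : members ⊤
      ↑-closed : ∀ {x y} → x ≤ y → members x → members y
      ∧-closed : ∀ {x y} → members x → members y → members (x ∧ y)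
      proper   : ¬ members ⊥
      prime    : ∀ {x y} → members (x ∨ y) → members x ⊎ members y

  open PrimeFilter using (members)

  infix 4 _∈_ _⊂ₛ_ codim_is_

  _∈_ : Carrier → PrimeFilter → Set (c ⊔ ℓ₁ ⊔ ℓ₂)
  x ∈ 𝔭 = members 𝔭 x

  _⊂ₛ_ : Rel PrimeFilter (c ⊔ ℓ₁ ⊔ ℓ₂)
  𝔭 ⊂ₛ 𝔮 = members 𝔭 ⊂ members 𝔮

  open FoundationRank _⊂ₛ_ public
    renaming (_≤rk_ to _≤height_; rk_<_ to height_<_; rk_is_ to height_is_)

  -- Ordinal minima: the value α is attained, and no smaller height occurs.
  -- When no prime filter containing x has a height, this holds for no α.
  codim_is_ : Carrier → Ordinal ι → Set (lsuc (c ⊔ ℓ₁ ⊔ ℓ₂) ⊔ ι)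
  codim x is α = (∃[ 𝔭 ] (x ∈ 𝔭 × height 𝔭 is α))
              × (∀ 𝔮 → x ∈ 𝔮 → ¬ (height 𝔮 < α))

  -- The graph of the distance function.  Deciding whether the codimension is
  -- finite needs excluded middle, so the distance is not definable as a
  -- function; `dist-unique` and `dist-total` below show that its graph is
  -- single-valued and, classically, total.  All its values are rational.
  dist : Carrier → Carrier → ℚ → Set (lsuc (c ⊔ ℓ₁ ⊔ ℓ₂))
  dist x y d = (∃[ n ] (codim (x △ y) is fromℕ n × d ≡ ½ ^ n))
             ⊎ (¬ (∃[ n ] (codim (x △ y) is fromℕ n)) × d ≡ 0ℚ)

  infix 4 _⟶_

  _⟶_ : (ℕ → Carrier) → Carrier → Set (lsuc (c ⊔ ℓ₁ ⊔ ℓ₂))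
  x ⟶ y = ∀ ε → 0ℚ <ℚ ε →
    ∃[ N ] (∀ n → N ℕ.≤ n → ∀ d → dist (x n) y d → d <ℚ ε)

  ≤height-down : ∀ {m n 𝔭} → m ℕ.≤ n → fromℕ n ≤height 𝔭 → fromℕ m ≤height 𝔭
  ≤height-down ℕ.z≤n       _             = tt
  ≤height-down (ℕ.s≤s m≤n) (𝔮 , 𝔮⊂𝔭 , h) = 𝔮 , 𝔮⊂𝔭 , ≤height-down m≤n h

  codim-unique : ∀ {x m n} → codim x is fromℕ m → codim x is fromℕ n → m ≡ n
  codim-unique {m = m} {n} ((𝔭 , x∈𝔭 , _ , p<) , minₘ) ((𝔮 , x∈𝔮 , _ , q<) , minₙ)
    with <-cmp m n
  ... | tri< m<n _ _ = ⊥-elim (minₙ 𝔭 x∈𝔭 λ n≤ → p< (≤height-down m<n n≤))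
  ... | tri≈ _ m≡n _ = m≡n
  ... | tri> _ _ n<m = ⊥-elim (minₘ 𝔮 x∈𝔮 λ m≤ → q< (≤height-down n<m m≤))

  dist-unique : ∀ {x y d e} → dist x y d → dist x y e → d ≡ e
  dist-unique (inj₁ (m , cm , p)) (inj₁ (n , cn , q)) =
    trans p (trans (cong (½ ^_) (codim-unique cm cn)) (sym q))
  dist-unique (inj₁ (m , cm , _)) (inj₂ (¬fin , _)) = ⊥-elim (¬fin (m , cm))
  dist-unique (inj₂ (¬fin , _)) (inj₁ (n , cn , _)) = ⊥-elim (¬fin (n , cn))
  dist-unique (inj₂ (_ , p)) (inj₂ (_ , q)) = trans p (sym q)

  dist-total : ∀ x y → ¬ ¬ (∃[ d ] dist x y d)
  dist-total x y k =
    k (0ℚ , inj₂ ((λ (n , cn) → k (½ ^ n , inj₁ (n , cn , refl))) , refl))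

{-# OPTIONS --safe #-}

-- In any co-Heyting algebra c ≤ b ≤ a gives b △ l ≤ (a △ l) ∨ (c △ l), so a
-- prime filter containing b △ l contains a △ l or c △ l; hence a finite
-- codimension of b △ l bounds that of one of the other two.  The existence of
-- the latter codimension is a minimum principle, available only up to double
-- negation, which suffices because the order on ℚ is decidable.
module Submission where

open import Defs
open import Level using (Level)
open import Data.Nat using (ℕ; zero; suc; z≤n; s≤s; _⊔_) renaming (_≤_ to _≤ℕ_)
import Data.Nat.Properties as ℕ
open import Data.Product using (_×_; _,_; proj₁; proj₂; ∃-syntax)
open import Data.Rational
  using (0ℚ; ½; 1ℚ; _≤?_; _<?_; +-*-rawSemiring) renaming (_≤_ to _≤ℚ_; _<_ to _<ℚ_)
import Data.Rational.Properties as ℚ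
open import Data.Sum using (inj₁; inj₂)
open import Data.Unit.Polymorphic using (tt)
open import Algebra.Definitions.RawSemiring +-*-rawSemiring using (_^_)
import Relation.Binary.Lattice.Properties.JoinSemilattice as JoinSemilatticeProperties
open import Relation.Binary.PropositionalEquality using (refl)
open import Relation.Nullary using (¬_)
open import Relation.Nullary.Decidable using (decidable-stable; from-yes)

½^n≤1 : ∀ n → ½ ^ n ≤ℚ 1ℚ
½^n≤1 zero    = ℚ.≤-refl
½^n≤1 (suc n) =
  ℚ.≤-trans (ℚ.*-monoˡ-≤-nonNeg ½ (½^n≤1 n)) (from-yes (½ ≤? 1ℚ))

½^-antitone : ∀ {m n} → m ≤ℕ n → ½ ^ n ≤ℚ ½ ^ m
½^-antitone {n = n} z≤n = ½^n≤1 n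
½^-antitone (s≤s m≤n)   = ℚ.*-monoˡ-≤-nonNeg ½ (½^-antitone m≤n)

module _ {c ℓ₁ ℓ₂ : Level} (L : CoHeytingAlgebra c ℓ₁ ℓ₂) where
  open CoHeytingAlgebra L renaming (refl to ≤-refl; trans to ≤-trans)
  open Codimetric L
  open PrimeFilter using (↑-closed; prime)
  open JoinSemilatticeProperties joinSemilattice using (∨-monotonic)

  x≤y∨[x-y] : ∀ x y → x ≤ y ∨ (x - y)
  x≤y∨[x-y] x y = proj₁ (-‿isMin x y)

  -- By minimality of `x - y`, since `x ≤ x′ ≤ y′ ∨ (x′ - y′) ≤ y ∨ (x′ - y′)`.
  -‿mono : ∀ {x x′ y y′} → x ≤ x′ → y′ ≤ y → x - y ≤ x′ - y′
  -‿mono {x} {x′} {y} {y′} x≤x′ y′≤y = proj₂ (-‿isMin x y) (x′ - y′)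
    (≤-trans x≤x′ (≤-trans (x≤y∨[x-y] x′ y′) (∨-monotonic y′≤y ≤-refl)))

  -- The upper bound `z` controls `y - l`, and the lower bound `x` controls `l - y`.
  △-squeeze : ∀ {x y z} l → x ≤ y → y ≤ z → y △ l ≤ (z △ l) ∨ (x △ l)
  △-squeeze {x} {y} {z} l x≤y y≤z = ∨-monotonic
    (≤-trans (-‿mono y≤z ≤-refl) (x≤x∨y (z - l) (l - z)))
    (≤-trans (-‿mono ≤-refl x≤y) (y≤x∨y (x - l) (l - x)))

  -- Least number principle by induction on `m`: if no codimension up to `m` occurs, then no prime
  -- filter containing `x` has height below `m`, so `𝔭` has height exactly `m` and attains the
  -- minimum, a contradiction.
  codim≤height : ∀ {x} m 𝔭 → x ∈ 𝔭 → height 𝔭 < fromℕ (suc m) →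
                 ¬ ¬ (∃[ k ] (k ≤ℕ m × codim x is fromℕ k))
  codim≤height {x} m 𝔭 x∈𝔭 𝔭<1+m none = minimal m none 𝔭 x∈𝔭 λ m≤𝔭 →
    none (m , ℕ.≤-refl , (𝔭 , x∈𝔭 , m≤𝔭 , 𝔭<1+m) , minimal m none)
    where
    minimal : ∀ m → ¬ (∃[ k ] (k ≤ℕ m × codim x is fromℕ k)) →
              ∀ 𝔮 → x ∈ 𝔮 → ¬ (height 𝔮 < fromℕ m)
    minimal zero    _    𝔮 x∈𝔮 𝔮<m = 𝔮<m tt
    minimal (suc m) none 𝔮 x∈𝔮 𝔮<m = codim≤height m 𝔮 x∈𝔮 𝔮<m
      λ (k , k≤m , codim≡k) → none (k , ℕ.m≤n⇒m≤1+n k≤m , codim≡k)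

  ½^height< : ∀ {x y ε} m 𝔭 → x △ y ∈ 𝔭 → height 𝔭 < fromℕ (suc m) →
              (∀ d → dist x y d → d <ℚ ε) → ½ ^ m <ℚ ε
  ½^height< {ε = ε} m 𝔭 ∈𝔭 𝔭<1+m near = decidable-stable (½ ^ m <? ε) λ ≮ε →
    codim≤height m 𝔭 ∈𝔭 𝔭<1+m λ (k , k≤m , codim≡k) →
      -- The codimension `k` may be smaller than `m`, which only makes the distance larger:
      -- `½ ^ m ≤ ½ ^ k < ε`.
      ≮ε (ℚ.≤-<-trans (½^-antitone k≤m) (near (½ ^ k) (inj₁ (k , codim≡k , refl))))

  dist-squeeze : ∀ {x y z l ε} → x ≤ y → y ≤ z → 0ℚ <ℚ ε →
                 (∀ d → dist z l d → d <ℚ ε) → (∀ d → dist x l d → d <ℚ ε) →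
                 ∀ d → dist y l d → d <ℚ ε
  -- Without a finite codimension the distance is `0ℚ`.
  dist-squeeze _ _ 0<ε _ _ _ (inj₂ (_ , refl)) = 0<ε
  dist-squeeze {l = l} x≤y y≤z _ z-near x-near _
    (inj₁ (m , ((𝔭 , ∈𝔭 , _ , 𝔭<1+m) , _) , refl))
    -- The filter `𝔭` attaining the codimension of `y △ l` also bounds that of `z △ l` or of
    -- `x △ l`.
    with prime 𝔭 (↑-closed 𝔭 (△-squeeze l x≤y y≤z) ∈𝔭)
  ... | inj₁ z∈𝔭 = ½^height< m 𝔭 z∈𝔭 𝔭<1+m z-near
  ... | inj₂ x∈𝔭 = ½^height< m 𝔭 x∈𝔭 𝔭<1+m x-near

theorem7p6 : ∀ {c ℓ₁ ℓ₂ : Level} (L : CoHeytingAlgebra c ℓ₁ ℓ₂) →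
    let open CoHeytingAlgebra L
        open Codimetric L in
    (a b c : ℕ → Carrier) (l : Carrier) →
    (∀ n → c n ≤ b n) → (∀ n → b n ≤ a n) →
    a ⟶ l → c ⟶ l → b ⟶ l
theorem7p6 L a b c l c≤b b≤a a⟶l c⟶l ε 0<ε with a⟶l ε 0<ε | c⟶l ε 0<ε
... | M , a-near | N , c-near = M ⊔ N , λ n M⊔N≤n →
  dist-squeeze L (c≤b n) (b≤a n) 0<ε
    (a-near n (ℕ.m⊔n≤o⇒m≤o M N M⊔N≤n)) (c-near n (ℕ.m⊔n≤o⇒n≤o M N M⊔N≤n))
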